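{- Fix a constant $B\ge 2$. In a $p[a,b]$-random SABT with total number of accesses $m$, where the search inside a node is a binary search costing $O(\log B)$, the expected search time of a key with $ac$ accesses is $O\!\left(\log_2\frac{m}{ac}\right)$.
   Context: A Generic Self-Adjusting Tree (GSAT) with degree function $D$ for a set of integer keys with access counts $ac_i\ge1$ consists of $m=\sum_i ac_i$, an array of $k\le\lceil D(m)\rceil$ representative keys with their access counts, and $k+1$ child subtrees that are GSATs for the keys lying strictly before the first representative, strictly between consecutive representatives, and strictly after the last. A GSAT is ideal if each child $T_j$ of the root satisfies $m(T_j)\le m/(D(m)+1)$, where $m(T_j)$ is the total access count of keys in $T_j$, and each child is ideal. An SABT is a GSAT with $D(m)=B$. Dynamic operations: each node $v$ has a counter $C(v)$ and $im(T_v)$, the value of $m(T_v)$ at the last (re)build of $T_v$; an operation on key $x$ walks the search path, increments counters of visited nodes and the access count of $x$ (insert of an absent key adds a new leaf with count 1, delete marks the key); then the shallowest visited $u$ with $C(u)>im(T_u)/4$ (if any) has $T_u$ rebuilt into an ideal SABT of its unmarked keys, resetting counters and $im$ values. Let $p$ be a probability mass function on the integers of $[a,b)$; a $p$-random operation is one whose key is drawn independently according to $p$. A $p[a,b]$-random SABT is obtained by drawing $n'$ keys independently according to $p$, building an ideal SABT using numbers of occurrences as access counts, and then performing a sequence of $p$-random inserts, deletes and gets. The search time of a key is the total time of in-node searches along the path from the root to the node containing it.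
   Formalization: The bound proved is C·max(1, log₂(m/ac)), since for m = ac the logarithm is 0 while a search costs at least one comparison; m is the number of accesses recorded at the root, which still counts accesses to deleted keys purged in a proper subtree until the root is rebuilt. -}

module Defs where

open import Level using (Level; suc; _⊔_)
open import Algebra.Apartness.Bundles using (HeytingField)
open import Algebra.Definitions.RawMonoid using (_×_)
open import Data.Bool.Base using (Bool; true; false; if_then_else_; not; _∧_)
open import Data.Integer.Base as ℤ using (ℤ; +_; 0ℤ)
import Data.Integer.Properties as ℤ
open import Data.List.Base using (List; []; _∷_; _++_; length; map; foldr; splitAt; upTo; filterᵇ)
open import Data.List.Relation.Unary.All using (All)
open import Data.List.Relation.Unary.AllPairs using (AllPairs)
open import Data.Maybe.Base using (Maybe; just; nothing; maybe)
open import Data.Nat.Base as ℕ using (ℕ; zero; ⌊_/2⌋; _≡ᵇ_; _<ᵇ_)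
open import Data.Nat.ListAction using (sum)
open import Data.Product.Base as Product using (_,_; proj₁; proj₂)
open import Data.Sum.Base using (_⊎_)
open import Data.Unit.Base using (⊤)
open import Data.Vec.Base as Vec using (Vec; []; _∷_)
open import Relation.Binary.Core using (Rel)
open import Relation.Binary.Definitions using (tri<; tri≈; tri>)
open import Relation.Binary.PropositionalEquality.Core using (_≡_)
open import Relation.Binary.Structures using (IsStrictPartialOrder)
open import Relation.Nullary.Negation.Core using (¬_)

------------------------------------------------------------------------
-- Trees

record Entry : Set where
  constructor entry
  field
    key    : ℤ
    ac     : ℕ
    marked : Bool          -- deleted, but not yet removed by a rebuild

open Entry public

-- In `node m im C s`, C is the counter and im the value of m at the last
-- (re)build.  m is set to the sum of the access counts when the subtree is
-- (re)built and afterwards grows by one with every access to a key below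
-- the node; a rebuild of a proper subtree does not touch it.
--
-- `Slots` alternates children and representatives:
-- T₀ ◁ e₁ ▷ (T₁ ◁ e₂ ▷ ( … last T_k)).

data Tree  : Set
data Slots : Set

infixr 5 _◁_▷_

data Tree where
  empty : Tree
  node  : (m im C : ℕ) → Slots → Tree

data Slots where
  last  : Tree → Slots
  _◁_▷_ : Tree → Entry → Slots → Slots

reps : Slots → List Entry
reps (last _)    = []
reps (_ ◁ e ▷ s) = e ∷ reps s

entries  : Tree → List Entry
entriesˢ : Slots → List Entry

entries empty          = []
entries (node _ _ _ s) = entriesˢ s

entriesˢ (last T)    = entries T
entriesˢ (T ◁ e ▷ s) = entries T ++ e ∷ entriesˢ s

weight : Tree → ℕ
weight T = sum (map ac (entries T))

accesses : Tree → ℕ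
accesses empty          = 0
accesses (node m _ _ _) = m

------------------------------------------------------------------------
-- GSATs and ideal GSATs with degree function D.  Together with
-- `entries T ≡ es` for a strictly sorted es (see `IdealBuilder`), the keys
-- of every child are exactly those lying strictly between the neighbouring
-- representatives.  The empty set of keys is represented by `empty` only,
-- hence 1 ≤ k.

GSAT  : (ℕ → ℕ) → Tree → Set
GSATˢ : (ℕ → ℕ) → Slots → Set

GSAT D empty            = ⊤
GSAT D (node m im C s)  =
  m ≡ weight (node m im C s)
  Product.× 1 ℕ.≤ length (reps s)
  Product.× length (reps s) ℕ.≤ D m
  Product.× GSATˢ D s

GSATˢ D (last T)    = GSAT D T
GSATˢ D (T ◁ _ ▷ s) = GSAT D T Product.× GSATˢ D s

-- m(T_j) ≤ m / (D(m) + 1), with the denominator cleared.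
Ideal  : (ℕ → ℕ) → Tree → Set
Idealˢ : (ℕ → ℕ) → ℕ → Slots → Set

Ideal D empty          = ⊤
Ideal D (node m _ _ s) = Idealˢ D m s

Idealˢ D m (last T)    = weight T ℕ.* (D m ℕ.+ 1) ℕ.≤ m Product.× Ideal D T
Idealˢ D m (T ◁ _ ▷ s) =
  (weight T ℕ.* (D m ℕ.+ 1) ℕ.≤ m Product.× Ideal D T) Product.× Idealˢ D m s

Fresh  : Tree → Set
Freshˢ : Slots → Set

Fresh empty           = ⊤
Fresh (node m im C s) = im ≡ m Product.× C ≡ 0 Product.× Freshˢ s

Freshˢ (last T)    = Fresh T
Freshˢ (T ◁ _ ▷ s) = Fresh T Product.× Freshˢ s

-- A key set has many ideal GSATs; a builder picks one of them.
record IdealBuilder (D : ℕ → ℕ) : Set where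
  field
    build : List Entry → Tree
    built : ∀ es →
            AllPairs (λ e f → key e ℤ.< key f) es →
            All (λ e → 1 ℕ.≤ ac e Product.× marked e ≡ false) es →
            entries (build es) ≡ es
            Product.× GSAT D (build es)
            Product.× Ideal D (build es)
            Product.× Fresh (build es)

open IdealBuilder public

SABTBuilder : ℕ → Set
SABTBuilder B = IdealBuilder (λ _ → B)

------------------------------------------------------------------------
-- Searching

find  : ℤ → Tree → Maybe Entry
findˢ : ℤ → Slots → Maybe Entry

find x empty          = nothing
find x (node _ _ _ s) = findˢ x s

findˢ x (last T) = find x T
findˢ x (T ◁ e ▷ s) with ℤ.<-cmp x (key e)
... | tri< _ _ _ = find x T
... | tri≈ _ _ _ = just e
... | tri> _ _ _ = findˢ x s

-- Number of three-way key comparisons made by a binary search for x in a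
-- sorted array; the first argument is fuel, for which the length suffices.
binarySearch : ℕ → ℤ → List ℤ → ℕ
binarySearch zero        x ks = 0
binarySearch (ℕ.suc n) x ks with splitAt ⌊ length ks /2⌋ ks
... | _ , []     = 0
... | l , y ∷ r with ℤ.<-cmp x y
...   | tri< _ _ _ = 1 ℕ.+ binarySearch n x l
...   | tri≈ _ _ _ = 1
...   | tri> _ _ _ = 1 ℕ.+ binarySearch n x r

nodeSearchTime : ℤ → Slots → ℕ
nodeSearchTime x s = binarySearch (length (reps s)) x (map key (reps s))

searchTime  : ℤ → Tree → ℕ
searchTimeˢ : ℤ → Slots → ℕ     -- the part spent below the current node

searchTime x empty          = 0
searchTime x (node _ _ _ s) = nodeSearchTime x s ℕ.+ searchTimeˢ x s

searchTimeˢ x (last T) = searchTime x T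
searchTimeˢ x (T ◁ e ▷ s) with ℤ.<-cmp x (key e)
... | tri< _ _ _ = searchTime x T
... | tri≈ _ _ _ = 0
... | tri> _ _ _ = searchTimeˢ x s

------------------------------------------------------------------------
-- Operations

data Op : Set where
  insert delete get : Op

access : Op → Entry → Entry
access insert (entry k n _) = entry k (n ℕ.+ 1) false
access delete (entry k n _) = entry k (n ℕ.+ 1) true
access get    (entry k n d) = entry k (n ℕ.+ 1) d

-- The first component is 1 if the access was recorded at some key, and 0
-- for a get or delete of a key that does not occur in the tree.
walk  : Op → ℤ → Tree → ℕ Product.× Tree
walkˢ : Op → ℤ → Slots → ℕ Product.× Slots

walk insert x empty = 1 , node 1 1 0 (empty ◁ entry x 1 false ▷ last empty)
walk delete x empty = 0 , empty
walk get    x empty = 0 , empty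
walk o x (node m im C s) with walkˢ o x s
... | δ , s′ = δ , node (m ℕ.+ δ) im (C ℕ.+ 1) s′

walkˢ o x (last T) = Product.map₂ last (walk o x T)
walkˢ o x (T ◁ e ▷ s) with ℤ.<-cmp x (key e)
... | tri< _ _ _ = Product.map₂ (_◁ e ▷ s) (walk o x T)
... | tri≈ _ _ _ = 1 , T ◁ access o e ▷ s
... | tri> _ _ _ = Product.map₂ (T ◁ e ▷_) (walkˢ o x s)

module _ (build : List Entry → Tree) where

  -- Rebuilds the shallowest T_u on the search path of x with C(u) > im(T_u)/4.
  rebuild  : ℤ → Tree → Tree
  rebuildˢ : ℤ → Slots → Slots

  rebuild x empty = empty
  rebuild x (node m im C s) =
    if im <ᵇ 4 ℕ.* C
    then build (filterᵇ (λ e → not (marked e)) (entriesˢ s))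
    else node m im C (rebuildˢ x s)

  rebuildˢ x (last T) = last (rebuild x T)
  rebuildˢ x (T ◁ e ▷ s) with ℤ.<-cmp x (key e)
  ... | tri< _ _ _ = rebuild x T ◁ e ▷ s
  ... | tri≈ _ _ _ = T ◁ e ▷ s
  ... | tri> _ _ _ = T ◁ e ▷ rebuildˢ x s

  perform : Op → ℤ → Tree → Tree
  perform o x T = rebuild x (proj₂ (walk o x T))

  performAll : ∀ {n} → Vec Op n → Vec ℤ n → Tree → Tree
  performAll []       []       T = T
  performAll (o ∷ os) (x ∷ xs) T = performAll os xs (perform o x T)

count : ℤ → List Entry → List Entry
count x [] = entry x 1 false ∷ []
count x (e ∷ es) with ℤ.<-cmp x (key e)
... | tri< _ _ _ = entry x 1 false ∷ e ∷ es
... | tri≈ _ _ _ = entry (key e) (ac e ℕ.+ 1) (marked e) ∷ es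
... | tri> _ _ _ = e ∷ count x es

-- The distinct keys of a sample in increasing order, with their numbers of
-- occurrences.
tally : List ℤ → List Entry
tally = foldr count []

------------------------------------------------------------------------
-- Ordered fields.  The real numbers are an instance; neither decidability
-- nor totality of the order is assumed.

record OrderedField (c ℓ₁ ℓ₂ : Level) : Set (suc (c ⊔ ℓ₁ ⊔ ℓ₂)) where
  field
    heytingField : HeytingField c ℓ₁ ℓ₂

  open HeytingField heytingField public

  infix 4 _<_ _≤_

  field
    _<_                  : Rel Carrier ℓ₂
    isStrictPartialOrder : IsStrictPartialOrder _≈_ _<_
    <⇒#                  : ∀ {x y} → x < y → x # y
    #⇒<⊎>                : ∀ {x y} → x # y → x < y ⊎ y < x
    +-monoˡ-<            : ∀ z {x y} → x < y → x + z < y + z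
    *-positive           : ∀ {x y} → 0# < x → 0# < y → 0# < x * y

  _≤_ : Rel Carrier ℓ₂
  x ≤ y = ¬ (y < x)

  fromℕ : ℕ → Carrier
  fromℕ n = _×_ (record { Carrier = Carrier; _≈_ = _≈_; _∙_ = _+_; ε = 0# }) n 1#

  sumOver : List ℤ → (ℤ → Carrier) → Carrier
  sumOver xs f = foldr (λ x y → f x + y) 0# xs

  -- The library phrases invertibility of x as that of x - 0#.
  inverse : ∀ x → 0# < x → Carrier
  inverse x 0<x = proj₁ (#⇒invertible (#-sym (<⇒# 0<x)))

------------------------------------------------------------------------
-- Probability

-- The integers of [a , b); empty if b ≤ a.
range : ℤ → ℤ → List ℤ
range a b = map (λ i → a ℤ.+ + i) (upTo ℤ.∣ (b ℤ.- a) ℤ.⊔ 0ℤ ∣)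

module Probability {c ℓ₁ ℓ₂ : Level} (F : OrderedField c ℓ₁ ℓ₂) where

  open OrderedField F

  record PMF (a b : ℤ) : Set (c ⊔ ℓ₁ ⊔ ℓ₂) where
    field
      mass        : ℤ → Carrier
      nonnegative : ∀ x → a ℤ.≤ x → x ℤ.< b → 0# ≤ mass x
      normalised  : sumOver (range a b) mass ≈ 1#

  open PMF public

  -- The expectation of f over n independent draws from p.
  expectIID : ∀ {a b} → PMF a b → (n : ℕ) → (Vec ℤ n → Carrier) → Carrier
  expectIID         p zero        f = f []
  expectIID {a} {b} p (ℕ.suc n) f =
    sumOver (range a b) (λ x → mass p x * expectIID p n (λ xs → f (x ∷ xs)))

  -- A p[a,b]-random SABT: n′ draws for the initial tree, then one draw for
  -- each of the prescribed operations.
  module RandomSABT {B : ℕ} (builder : SABTBuilder B) {a b : ℤ} (p : PMF a b)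
                    (n′ : ℕ) {n : ℕ} (ops : Vec Op n) where

    sabt : Vec ℤ n′ → Vec ℤ n → Tree
    sabt ks xs =
      performAll (build builder) ops xs (build builder (tally (Vec.toList ks)))

    expectation : (Tree → Carrier) → Carrier
    expectation f =
      expectIID p n′ (λ ks → expectIID p n (λ xs → f (sabt ks xs)))

    probability : (Tree → Bool) → Carrier
    probability A = expectation (λ T → if A T then 1# else 0#)

    -- E[f | A]
    conditionalExpectation : (f : Tree → Carrier) (A : Tree → Bool) →
                             0# < probability A → Carrier
    conditionalExpectation f A 0<A =
      expectation (λ T → if A T then f T else 0#) * inverse (probability A) 0<A

  -- E ≤ C · max(1 , log₂(m/n)).  The fractions u/v range over all rationals
  -- with u/v ≥ 1 and u/v ≥ log₂(m/n), i.e. 2^(u/v) ≥ m/n, and the maximum is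
  -- their infimum.  The maximum equals log₂(m/n) as soon as m ≥ 2n; a bound
  -- by a multiple of log₂(m/n) alone is impossible for m = n, where the
  -- logarithm vanishes although the search makes at least one comparison.
  _≤_·log₂[_/_] : Carrier → ℕ → ℕ → ℕ → Set ℓ₂
  E ≤ C ·log₂[ m / n ] =
    ∀ u v → 1 ℕ.≤ v → v ℕ.≤ u → m ℕ.^ v ℕ.≤ 2 ℕ.^ u ℕ.* n ℕ.^ v →
    fromℕ v * E ≤ fromℕ (C ℕ.* u)

-- T has recorded m accesses in total, and x is one of its (undeleted) keys,
-- with n accesses.
hasKeyWith : (x : ℤ) (m n : ℕ) → Tree → Bool
hasKeyWith x m n T =
  (accesses T ≡ᵇ m) ∧ maybe (λ e → not (marked e) ∧ (ac e ≡ᵇ n)) false (find x T)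

{-# OPTIONS --safe #-}
module Submission where

-- The bound holds for every reachable tree, hence for the expectation under
-- any distribution.  Let v be a node and w a child of v.  When v was last
-- built, w had at most im(v)/(B+1) ≤ im(v)/3 accesses; it has gained at most
-- C(v) ≤ im(v)/4 since then, because otherwise v would have been rebuilt.  As
-- im(v) ≤ m(v), this gives m(w) ≤ (7/12) m(v), and (7/12)² ≤ 1/2, so the
-- square of m halves at every step of a search path.  The node holding a key
-- with n accesses has m ≥ n, so it lies at depth at most 2 log₂(m/n).

open import Defs
open import Algebra.Apartness.Bundles using (HeytingCommutativeRing)
open import Algebra.Bundles using (CommutativeRing)
open import Data.Bool.Base using (true; false; not; T; if_then_else_)
open import Data.Bool.Properties using (T-not-≡; T-≡; T?)
open import Data.Integer.Base as ℤ using (ℤ; 0ℤ)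
import Data.Integer.Properties as ℤ
open import Data.List.Base using (List; []; _∷_; _++_; length; map; filterᵇ; splitAt)
open import Data.List.Properties using (map-++)
open import Data.List.Relation.Binary.Sublist.Propositional using (_⊆_; []; _∷_; _∷ʳ_; ⊆-refl; ⊆-trans; ⊆-reflexive)
open import Data.List.Relation.Binary.Sublist.Propositional.Properties using (All-resp-⊆; ++⁺; filter-⊆)
open import Data.List.Relation.Unary.All as All using (All; []; _∷_)
open import Data.List.Relation.Unary.All.Properties as All using (all-filter)
open import Data.List.Relation.Unary.AllPairs using (AllPairs; []; _∷_)
open import Data.List.Relation.Unary.AllPairs.Properties as AllPairs using ()
open import Data.Maybe.Base using (just)
open import Data.Nat.Base as ℕ using (ℕ; zero; suc; _+_; _*_; _∸_; _^_; _≤_; _<ᵇ_; z≤n; s≤s; NonZero; >-nonZero; ⌊_/2⌋)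
open import Data.Nat.ListAction using (sum)
open import Data.Nat.ListAction.Properties using (sum-++)
import Data.Nat.Properties as ℕ
open import Data.Nat.Solver using (module +-*-Solver)
open import Data.Product.Base using (_×_; _,_; proj₁; proj₂; ∃-syntax)
open import Data.Sum.Base using (_⊎_; inj₁; inj₂)
open import Data.Vec.Base as Vec using (Vec; []; _∷_)
open import Function.Bundles using (Equivalence)
open import Relation.Binary.Core using (Rel)
open import Relation.Binary.Definitions using (Transitive; tri<; tri≈; tri>)
open import Relation.Binary.PropositionalEquality using (_≡_; refl; sym; trans; cong; cong₂; subst)
open import Relation.Binary.Structures using (IsStrictPartialOrder)
open import Relation.Nullary.Negation.Core using (contradiction)

-- Pairwise relations on sublists and concatenations.

module _ {a ℓ} {A : Set a} {R : Rel A ℓ} where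

  AllPairs-resp-⊆ : ∀ {xs ys : List A} → xs ⊆ ys → AllPairs R ys → AllPairs R xs
  AllPairs-resp-⊆ []         []       = []
  AllPairs-resp-⊆ (_ ∷ʳ p)   (_ ∷ rs) = AllPairs-resp-⊆ p rs
  AllPairs-resp-⊆ (refl ∷ p) (r ∷ rs) = All-resp-⊆ p r ∷ AllPairs-resp-⊆ p rs

  AllPairs-++-∷⁻ : ∀ xs {y ys} → AllPairs R (xs ++ y ∷ ys) →
                   AllPairs R xs × All (λ x → R x y) xs × All (R y) ys × AllPairs R ys
  AllPairs-++-∷⁻ []       (r ∷ rs) = [] , [] , r , rs
  AllPairs-++-∷⁻ (x ∷ xs) (r ∷ rs) with AllPairs-++-∷⁻ xs rs | All.++⁻ xs r
  ... | p , q , u , v | rx , ry ∷ _ = rx ∷ p , ry ∷ q , u , v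

  -- The pairs with one element in `xs` and the other in `ys` are obtained by transitivity through
  -- `y`.
  AllPairs-++-∷⁺ : Transitive R → ∀ {xs y ys} → AllPairs R xs → All (λ x → R x y) xs →
                   All (R y) ys → AllPairs R ys → AllPairs R (xs ++ y ∷ ys)
  AllPairs-++-∷⁺ tr p q u v =
    AllPairs.++⁺ p (u ∷ v) (All.map (λ xy → xy ∷ All.map (tr xy) u) q)

-- Sorted lists of entries and their total access counts.

_≺_ : Rel Entry _
e ≺ f = key e ℤ.< key f

Sorted : List Entry → Set
Sorted = AllPairs _≺_

Positive : List Entry → Set
Positive = All (λ e → 1 ≤ ac e)

total : List Entry → ℕ
total es = sum (map ac es)

sorted-++-∷⁺ : ∀ {es e fs} → Sorted es → All (_≺ e) es → All (e ≺_) fs → Sorted fs →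
               Sorted (es ++ e ∷ fs)
sorted-++-∷⁺ = AllPairs-++-∷⁺ (λ {e} {f} {g} → ℤ.<-trans {key e} {key f} {key g})

total-++-∷ : ∀ es e fs → total (es ++ e ∷ fs) ≡ total es + (ac e + total fs)
total-++-∷ es e fs = trans (cong sum (map-++ ac es (e ∷ fs))) (sum-++ (map ac es) _)

total-mono-⊆ : ∀ {es fs} → es ⊆ fs → total es ≤ total fs
total-mono-⊆ []         = z≤n
total-mono-⊆ (f ∷ʳ p)   = ℕ.≤-trans (total-mono-⊆ p) (ℕ.m≤n+m _ (ac f))
total-mono-⊆ {e ∷ _} (refl ∷ p) = ℕ.+-monoʳ-≤ (ac e) (total-mono-⊆ p)

-- Single accesses and the tally of a sample.

key-access : ∀ o e → key (access o e) ≡ key e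
key-access insert e = refl
key-access delete e = refl
key-access get    e = refl

ac-access : ∀ o e → ac (access o e) ≡ ac e + 1
ac-access insert e = refl
ac-access delete e = refl
ac-access get    e = refl

-- Stated for any `P` stable under raising the count, because it serves twice: with `e ≺_` for
-- sortedness of a tally, and with cleanness.
count-All : (P : Entry → Set) → (∀ {e} → P e → P (entry (key e) (ac e + 1) (marked e))) →
            ∀ {x} → P (entry x 1 false) → ∀ {es} → All P es → All P (count x es)
count-All P access-P new []       = new ∷ []
count-All P access-P {x} new {e ∷ es} (p ∷ ps) with ℤ.<-cmp x (key e)
... | tri< _ _ _ = new ∷ p ∷ ps
... | tri≈ _ _ _ = access-P p ∷ ps
... | tri> _ _ _ = p ∷ count-All P access-P new ps

count-sorted : ∀ x {es} → Sorted es → Sorted (count x es)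
count-sorted x []       = [] ∷ []
count-sorted x {e ∷ es} (p ∷ ps) with ℤ.<-cmp x (key e)
... | tri< x<e _ _ = (x<e ∷ All.map (ℤ.<-trans x<e) p) ∷ p ∷ ps
... | tri≈ _ _ _   = p ∷ ps
... | tri> _ _ e<x = count-All (e ≺_) (λ r → r) e<x p ∷ count-sorted x ps

Clean : List Entry → Set
Clean = All (λ e → 1 ≤ ac e × marked e ≡ false)

tally-sorted : ∀ xs → Sorted (tally xs)
tally-sorted []       = []
tally-sorted (x ∷ xs) = count-sorted x (tally-sorted xs)

tally-clean : ∀ xs → Clean (tally xs)
tally-clean []       = []
tally-clean (x ∷ xs) =
  count-All _ (λ (p , q) → ℕ.m≤n⇒m≤n+o 1 p , q) (ℕ.≤-refl , refl) (tally-clean xs)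

-- The walk along a search path.

walk-node : ∀ o x m im C s →
            walk o x (node m im C s) ≡
            (let (δ , s′) = walkˢ o x s in δ , node (m + δ) im (C + 1) s′)
-- Fixing the operation lets the clause of `walk` for nodes compute. The proofs below rewrite by
-- this equation and so keep `o` a variable.
walk-node insert x m im C s = refl
walk-node delete x m im C s = refl
walk-node get    x m im C s = refl

leaf : ℤ → Tree
leaf x = node 1 1 0 (empty ◁ entry x 1 false ▷ last empty)

walk-empty : ∀ o x → walk o x empty ≡ (1 , leaf x) ⊎ walk o x empty ≡ (0 , empty)
walk-empty insert x = inj₁ refl
walk-empty delete x = inj₂ refl
walk-empty get    x = inj₂ refl

module _ (o : Op) (x : ℤ) where

  walked : Tree → Tree
  walked t = proj₂ (walk o x t)

  walkedˢ : Slots → Slots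
  walkedˢ s = proj₂ (walkˢ o x s)

  module _ (P : Entry → Set) (access-P : ∀ {e} → P e → P (access o e))
           (new : P (entry x 1 false)) where

    -- A walk either accesses one entry, or adds a new one for `x`, or leaves the entries alone. The
    -- predicate is arbitrary so that it can be positivity of counts as well as a bound by a
    -- neighbouring representative.
    walk-All  : ∀ t → All P (entries t)  → All P (entries (walked t))
    walk-Allˢ : ∀ s → All P (entriesˢ s) → All P (entriesˢ (walkedˢ s))

    walk-All empty ps with walk o x empty | walk-empty o x
    ... | _ | inj₁ refl = new ∷ []
    ... | _ | inj₂ refl = []
    walk-All (node m im C s) ps rewrite walk-node o x m im C s = walk-Allˢ s ps

    walk-Allˢ (last t) ps = walk-All t ps
    walk-Allˢ (t ◁ e ▷ s) ps with ℤ.<-cmp x (key e) | All.++⁻ (entries t) ps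
    ... | tri< _ _ _ | l , r     = All.++⁺ (walk-All t l) r
    ... | tri≈ _ _ _ | l , q ∷ r = All.++⁺ l (access-P q ∷ r)
    ... | tri> _ _ _ | l , q ∷ r = All.++⁺ l (q ∷ walk-Allˢ s r)

  -- The comparison with a representative on the search path is exactly what puts a new key `x` on
  -- the correct side of it; an access leaves keys unchanged.
  walk-sorted  : ∀ t → Sorted (entries t)  → Sorted (entries (walked t))
  walk-sortedˢ : ∀ s → Sorted (entriesˢ s) → Sorted (entriesˢ (walkedˢ s))

  walk-sorted empty _ with walk o x empty | walk-empty o x
  ... | _ | inj₁ refl = [] ∷ []
  ... | _ | inj₂ refl = []
  walk-sorted (node m im C s) p rewrite walk-node o x m im C s = walk-sortedˢ s p

  walk-sortedˢ (last t) p = walk-sorted t p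
  walk-sortedˢ (t ◁ e ▷ s) p with ℤ.<-cmp x (key e) | AllPairs-++-∷⁻ (entries t) p
  ... | tri< x<e _ _ | l , l<e , e<r , r =
    sorted-++-∷⁺ (walk-sorted t l)
      (walk-All (_≺ e) (λ {f} → subst (ℤ._< key e) (sym (key-access o f))) x<e t l<e) e<r r
  ... | tri≈ _ _ _ | l , l<e , e<r , r =
    sorted-++-∷⁺ l
      (All.map (subst (_ ℤ.<_) (sym (key-access o e))) l<e)
      (All.map (subst (ℤ._< _) (sym (key-access o e))) e<r) r
  ... | tri> _ _ e<x | l , l<e , e<r , r =
    sorted-++-∷⁺ l l<e
      (walk-Allˢ (e ≺_) (λ {f} → subst (key e ℤ.<_) (sym (key-access o f))) e<x s e<r)
      (walk-sortedˢ s r)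

  walk-positive : ∀ t → Positive (entries t) → Positive (entries (walked t))
  walk-positive =
    walk-All _ (λ {e} p → subst (1 ≤_) (sym (ac-access o e)) (ℕ.m≤n⇒m≤n+o 1 p)) ℕ.≤-refl

  -- The first component of the walk is also what is added to `m` at each visited node, so this
  -- equation keeps the recorded `m` an upper bound for the total.
  walk-total  : ∀ t → total (entries (walked t))   ≡ total (entries t)  + proj₁ (walk o x t)
  walk-totalˢ : ∀ s → total (entriesˢ (walkedˢ s)) ≡ total (entriesˢ s) + proj₁ (walkˢ o x s)

  walk-total empty with walk o x empty | walk-empty o x
  ... | _ | inj₁ refl = refl
  ... | _ | inj₂ refl = refl
  walk-total (node m im C s) rewrite walk-node o x m im C s = walk-totalˢ s

  walk-totalˢ (last t) = walk-total t
  walk-totalˢ (t ◁ e ▷ s) with ℤ.<-cmp x (key e)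
  ... | tri< _ _ _
    rewrite total-++-∷ (entries (walked t)) e (entriesˢ s)
          | total-++-∷ (entries t) e (entriesˢ s) | walk-total t =
    solve 3 (λ a d r → (a :+ d) :+ r := (a :+ r) :+ d) refl
      (total (entries t)) (proj₁ (walk o x t)) _
    where open +-*-Solver
  ... | tri≈ _ _ _
    rewrite total-++-∷ (entries t) (access o e) (entriesˢ s)
          | total-++-∷ (entries t) e (entriesˢ s) | ac-access o e =
    solve 3 (λ a b c → a :+ ((b :+ con 1) :+ c) := (a :+ (b :+ c)) :+ con 1) refl
      (total (entries t)) (ac e) _
    where open +-*-Solver
  ... | tri> _ _ _
    rewrite total-++-∷ (entries t) e (entriesˢ (walkedˢ s))
          | total-++-∷ (entries t) e (entriesˢ s) | walk-totalˢ s =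
    solve 4 (λ a b c d → a :+ (b :+ (c :+ d)) := (a :+ (b :+ c)) :+ d) refl
      (total (entries t)) (ac e) (total (entriesˢ s)) _
    where open +-*-Solver

  walk-count≤1  : ∀ t → proj₁ (walk o x t) ≤ 1
  walk-count≤1ˢ : ∀ s → proj₁ (walkˢ o x s) ≤ 1

  walk-count≤1 empty with walk o x empty | walk-empty o x
  ... | _ | inj₁ refl = ℕ.≤-refl
  ... | _ | inj₂ refl = z≤n
  walk-count≤1 (node m im C s) rewrite walk-node o x m im C s = walk-count≤1ˢ s

  walk-count≤1ˢ (last t) = walk-count≤1 t
  walk-count≤1ˢ (t ◁ e ▷ s) with ℤ.<-cmp x (key e)
  ... | tri< _ _ _ = walk-count≤1 t
  ... | tri≈ _ _ _ = ℕ.≤-refl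
  ... | tri> _ _ _ = walk-count≤1ˢ s

  -- An inserted key becomes a new leaf node and never enlarges an existing array, so the degree
  -- bound survives.
  walk-reps : ∀ s → length (reps (walkedˢ s)) ≡ length (reps s)
  walk-reps (last t) = refl
  walk-reps (t ◁ e ▷ s) with ℤ.<-cmp x (key e)
  ... | tri< _ _ _ = refl
  ... | tri≈ _ _ _ = refl
  ... | tri> _ _ _ = cong suc (walk-reps s)

-- The balance invariant

-- Since the last build of a node its children have gained at most C accesses,
-- each of them starting from at most im / (B + 1).
module Balance (B : ℕ) where

  -- The total is only bounded by `m`: rebuilding a proper subtree discards marked entries without
  -- lowering the `m` of its ancestors. The index `k` bounds the accesses of every child with the
  -- denominator `B + 1` cleared.
  data Balanced  : Tree → Set
  data Balancedˢ (k : ℕ) : Slots → Set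

  data Balanced where
    empty : Balanced empty
    node  : ∀ {m im C s} → length (reps s) ≤ B → im ≤ m → 4 * C ≤ im →
            total (entriesˢ s) ≤ m → Balancedˢ (im + C * (B + 1)) s →
            Balanced (node m im C s)

  data Balancedˢ k where
    last  : ∀ {t} → accesses t * (B + 1) ≤ k → Balanced t → Balancedˢ k (last t)
    _◁_▷_ : ∀ {t s} → accesses t * (B + 1) ≤ k × Balanced t → ∀ e →
            Balancedˢ k s → Balancedˢ k (t ◁ e ▷ s)

  Balancedˢ-mono : ∀ {k l s} → k ≤ l → Balancedˢ k s → Balancedˢ l s
  Balancedˢ-mono k≤l (last a t)        = last (ℕ.≤-trans a k≤l) t
  Balancedˢ-mono k≤l ((a , t) ◁ e ▷ s) = (ℕ.≤-trans a k≤l , t) ◁ e ▷ Balancedˢ-mono k≤l s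

  GSAT⇒accesses≡total : ∀ t → GSAT (λ _ → B) t → accesses t ≡ total (entries t)
  GSAT⇒accesses≡total empty           _       = refl
  GSAT⇒accesses≡total (node _ _ _ _) (eq , _) = eq

  -- A fresh node has `im ≡ m` and `C ≡ 0`, so the index `im + C * (B + 1)` computes to `m + 0`, and
  -- the ideal condition on weights is the required bound on accesses.
  ideal⇒balanced  : ∀ t → GSAT (λ _ → B) t → Ideal (λ _ → B) t → Fresh t → Balanced t
  ideal⇒balancedˢ : ∀ m s → GSATˢ (λ _ → B) s → Idealˢ (λ _ → B) m s → Freshˢ s →
                    Balancedˢ (m + 0) s

  ideal⇒balanced empty _ _ _ = empty
  ideal⇒balanced (node m im C s) (m≡ , _ , reps≤B , g) i (refl , refl , f) =
    node reps≤B ℕ.≤-refl z≤n (ℕ.≤-reflexive (sym m≡)) (ideal⇒balancedˢ m s g i f)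

  ideal⇒balancedˢ m (last t) g (w≤ , i) f rewrite sym (GSAT⇒accesses≡total t g) =
    last (ℕ.m≤n⇒m≤n+o 0 w≤) (ideal⇒balanced t g i f)
  ideal⇒balancedˢ m (t ◁ e ▷ s) (g , gs) ((w≤ , i) , is) (f , fs)
    rewrite sym (GSAT⇒accesses≡total t g) =
    (ℕ.m≤n⇒m≤n+o 0 w≤ , ideal⇒balanced t g i f) ◁ e ▷ ideal⇒balancedˢ m s gs is fs

-- Preservation of balance

unmarked : List Entry → List Entry
unmarked = filterᵇ (λ e → not (marked e))

unmarked-⊆ : ∀ es → unmarked es ⊆ es
unmarked-⊆ = filter-⊆ (λ e → T? (not (marked e)))

unmarked-clean : ∀ {es} → Positive es → Clean (unmarked es)
unmarked-clean {es} pos = All.zip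
  ( All-resp-⊆ (unmarked-⊆ es) pos
  , All.map (Equivalence.to T-not-≡) (all-filter (λ e → T? (not (marked e))) es) )

module Performing {B : ℕ} (2≤B : 2 ≤ B) (builder : SABTBuilder B) where

  open Balance B

  build-balanced : ∀ {es} → Sorted es → Clean es →
                   Balanced (build builder es) × accesses (build builder es) ≡ total es
  build-balanced {es} sorted clean with built builder es sorted clean
  ... | es≡ , g , i , f =
    ideal⇒balanced _ g i f , trans (GSAT⇒accesses≡total _ g) (cong total es≡)

  build-unmarked-⊆ : ∀ {es} → Sorted es → Positive es →
                     entries (build builder (unmarked es)) ⊆ es
  build-unmarked-⊆ {es} sorted pos =
    ⊆-trans (⊆-reflexive (proj₁ (built builder _ (AllPairs-resp-⊆ (unmarked-⊆ es) sorted)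
                                                 (unmarked-clean pos))))
            (unmarked-⊆ es)

  -- A rebuild only drops marked entries. The sublist relation transports sortedness, positivity and
  -- the bound on the total at once.
  rebuild-⊆  : ∀ x t → Sorted (entries t) → Positive (entries t) →
               entries (rebuild (build builder) x t) ⊆ entries t
  rebuild-⊆ˢ : ∀ x s → Sorted (entriesˢ s) → Positive (entriesˢ s) →
               entriesˢ (rebuildˢ (build builder) x s) ⊆ entriesˢ s

  rebuild-⊆ x empty sorted pos = []
  rebuild-⊆ x (node m im C s) sorted pos with im <ᵇ 4 * C
  ... | true  = build-unmarked-⊆ sorted pos
  ... | false = rebuild-⊆ˢ x s sorted pos

  rebuild-⊆ˢ x (last t) sorted pos = rebuild-⊆ x t sorted pos
  rebuild-⊆ˢ x (t ◁ e ▷ s) sorted pos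
    with ℤ.<-cmp x (key e) | AllPairs-++-∷⁻ (entries t) sorted | All.++⁻ (entries t) pos
  ... | tri< _ _ _ | l , _ , _ , _ | pl , _     = ++⁺ (rebuild-⊆ x t l pl) ⊆-refl
  ... | tri≈ _ _ _ | _             | _          = ⊆-refl
  ... | tri> _ _ _ | _ , _ , _ , r | _ , _ ∷ pr = ++⁺ ⊆-refl (refl ∷ rebuild-⊆ˢ x s r pr)

  rebuild-reps : ∀ x s → length (reps (rebuildˢ (build builder) x s)) ≡ length (reps s)
  rebuild-reps x (last t) = refl
  rebuild-reps x (t ◁ e ▷ s) with ℤ.<-cmp x (key e)
  ... | tri< _ _ _ = refl
  ... | tri≈ _ _ _ = refl
  ... | tri> _ _ _ = cong suc (rebuild-reps x s)

  module _ {x : ℤ} {e : Entry} {t : Tree} {s : Slots} where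

    -- `perform` compares `x` with a representative twice, in the walk and in the rebuild. These
    -- three equations settle the second comparison once the first is decided.
    rebuildˢ-< : x ℤ.< key e → rebuildˢ (build builder) x (t ◁ e ▷ s) ≡
                               rebuild (build builder) x t ◁ e ▷ s
    rebuildˢ-< x<e with ℤ.<-cmp x (key e)
    ... | tri< _ _ _   = refl
    ... | tri≈ x≮e _ _ = contradiction x<e x≮e
    ... | tri> x≮e _ _ = contradiction x<e x≮e

    rebuildˢ-≡ : x ≡ key e → rebuildˢ (build builder) x (t ◁ e ▷ s) ≡ t ◁ e ▷ s
    rebuildˢ-≡ x≡e with ℤ.<-cmp x (key e)
    ... | tri< _ x≢e _ = contradiction x≡e x≢e
    ... | tri≈ _ _ _   = refl
    ... | tri> _ x≢e _ = contradiction x≡e x≢e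

    rebuildˢ-> : key e ℤ.< x → rebuildˢ (build builder) x (t ◁ e ▷ s) ≡
                               t ◁ e ▷ rebuildˢ (build builder) x s
    rebuildˢ-> e<x with ℤ.<-cmp x (key e)
    ... | tri< _ _ e≮x = contradiction e<x e≮x
    ... | tri≈ _ _ e≮x = contradiction e<x e≮x
    ... | tri> _ _ _   = refl

  -- One operation adds at most one access to a child while the counter of the parent grows by one,
  -- which raises the index by `B + 1`.
  child-bound : ∀ {a a′ k} → a′ ≤ a + 1 → a * (B + 1) ≤ k → a′ * (B + 1) ≤ k + (B + 1)
  child-bound {a} {a′} {k} a′≤ a≤k = begin
    a′ * (B + 1)           ≤⟨ ℕ.*-monoˡ-≤ (B + 1) a′≤ ⟩
    (a + 1) * (B + 1)      ≡⟨ solve 2 (λ a b → (a :+ con 1) :* b := a :* b :+ b) refl a (B + 1) ⟩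
    a * (B + 1) + (B + 1)  ≤⟨ ℕ.+-monoˡ-≤ (B + 1) a≤k ⟩
    k + (B + 1)            ∎
    where open ℕ.≤-Reasoning
          open +-*-Solver

  module _ (o : Op) (x : ℤ) where

    performˢ : Slots → Slots
    performˢ s = rebuildˢ (build builder) x (walkedˢ o x s)

    perform-⊆ : ∀ t → Sorted (entries t) → Positive (entries t) →
                entries (perform (build builder) o x t) ⊆ entries (walked o x t)
    perform-⊆ t sorted pos =
      rebuild-⊆ x (walked o x t) (walk-sorted o x t sorted) (walk-positive o x t pos)

    perform-sorted : ∀ t → Sorted (entries t) → Positive (entries t) →
                     Sorted (entries (perform (build builder) o x t))
    perform-sorted t sorted pos =
      AllPairs-resp-⊆ (perform-⊆ t sorted pos) (walk-sorted o x t sorted)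

    perform-positive : ∀ t → Sorted (entries t) → Positive (entries t) →
                       Positive (entries (perform (build builder) o x t))
    perform-positive t sorted pos =
      All-resp-⊆ (perform-⊆ t sorted pos) (walk-positive o x t pos)

    -- A node whose counter is too large becomes ideal again, with `m` reset to the total of its
    -- unmarked entries; otherwise balance is inherited with the counter raised by one. The bound on
    -- `accesses` is proved along with it because the parent needs it for `child-bound`.
    perform-balanced  : ∀ t → Sorted (entries t) → Positive (entries t) → Balanced t →
                        Balanced (perform (build builder) o x t) ×
                        accesses (perform (build builder) o x t) ≤ accesses t + 1
    perform-balancedˢ : ∀ {k} s → Sorted (entriesˢ s) → Positive (entriesˢ s) →
                        Balancedˢ k s → Balancedˢ (k + (B + 1)) (performˢ s)

    perform-balanced empty _ _ empty with walk o x empty | walk-empty o x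
    ... | _ | inj₂ refl = empty , z≤n
    -- The new leaf has `im` 1 and `C` 0, so it passes the rebuild test, and the search stops at its
    -- own key.
    ... | _ | inj₁ refl rewrite rebuildˢ-≡ {x} {entry x 1 false} {empty} {last empty} refl =
      node (ℕ.≤-trans (s≤s z≤n) 2≤B) ℕ.≤-refl z≤n ℕ.≤-refl
           ((z≤n , empty) ◁ entry x 1 false ▷ last z≤n empty) , ℕ.≤-refl
    perform-balanced (node m im C s) sorted pos (node reps≤B im≤m 4C≤im total≤m bs)
      with walk-sorted o x (node m im C s) sorted | walk-positive o x (node m im C s) pos
    ... | sorted′ | pos′ rewrite walk-node o x m im C s
      with im <ᵇ 4 * (C + 1) in eq
    ... | true  = proj₁ balanced , (begin
      accesses (build builder (unmarked es))  ≡⟨ proj₂ balanced ⟩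
      total (unmarked es)                     ≤⟨ total-mono-⊆ (unmarked-⊆ es) ⟩
      total es                                ≤⟨ total≤ ⟩
      m + δ                                   ≤⟨ ℕ.+-monoʳ-≤ m (walk-count≤1ˢ o x s) ⟩
      m + 1                                   ∎)
      where
      open ℕ.≤-Reasoning
      es = entriesˢ (walkedˢ o x s)
      δ  = proj₁ (walkˢ o x s)
      balanced = build-balanced (AllPairs-resp-⊆ (unmarked-⊆ es) sorted′) (unmarked-clean pos′)
      total≤ : total es ≤ m + δ
      total≤ = ℕ.≤-trans (ℕ.≤-reflexive (walk-totalˢ o x s)) (ℕ.+-monoˡ-≤ δ total≤m)
    ... | false =
      node (ℕ.≤-trans (ℕ.≤-reflexive (trans (rebuild-reps x (walkedˢ o x s)) (walk-reps o x s))) reps≤B)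
           (ℕ.m≤n⇒m≤n+o δ im≤m)
           -- The failed rebuild test is the invariant `4 * C ≤ im` for the incremented counter.
           (ℕ.≮⇒≥ (λ lt → subst T eq (ℕ.<⇒<ᵇ lt)))
           (ℕ.≤-trans (total-mono-⊆ (rebuild-⊆ˢ x (walkedˢ o x s) sorted′ pos′)) total≤)
           (subst (λ k → Balancedˢ k (performˢ s)) k≡ (perform-balancedˢ s sorted pos bs))
      , ℕ.+-monoʳ-≤ m (walk-count≤1ˢ o x s)
      where
      δ  = proj₁ (walkˢ o x s)
      total≤ : total (entriesˢ (walkedˢ o x s)) ≤ m + δ
      total≤ = ℕ.≤-trans (ℕ.≤-reflexive (walk-totalˢ o x s)) (ℕ.+-monoˡ-≤ δ total≤m)
      k≡ : im + C * (B + 1) + (B + 1) ≡ im + (C + 1) * (B + 1)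
      k≡ = solve 3 (λ i c b → i :+ c :* b :+ b := i :+ (c :+ con 1) :* b) refl im C (B + 1)
        where open +-*-Solver

    perform-balancedˢ (last t) sorted pos (last a b) with perform-balanced t sorted pos b
    ... | b′ , a′ = last (child-bound a′ a) b′
    perform-balancedˢ {k} (t ◁ e ▷ s) sorted pos ((a , b) ◁ .e ▷ bs)
      with ℤ.<-cmp x (key e) | AllPairs-++-∷⁻ (entries t) sorted | All.++⁻ (entries t) pos
    ... | tri< x<e _ _ | l , _ , _ , _ | pl , _
      rewrite rebuildˢ-< {x} {e} {walked o x t} {s} x<e with perform-balanced t l pl b
    ...   | b′ , a′ = (child-bound a′ a , b′) ◁ e ▷ Balancedˢ-mono (ℕ.m≤m+n k _) bs
    perform-balancedˢ {k} (t ◁ e ▷ s) sorted pos ((a , b) ◁ .e ▷ bs)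
        | tri≈ _ x≡e _ | _ | _
      rewrite rebuildˢ-≡ {x} {access o e} {t} {s} (trans x≡e (sym (key-access o e))) =
      (ℕ.m≤n⇒m≤n+o _ a , b) ◁ access o e ▷ Balancedˢ-mono (ℕ.m≤m+n k _) bs
    perform-balancedˢ {k} (t ◁ e ▷ s) sorted pos ((a , b) ◁ .e ▷ bs)
        | tri> _ _ e<x | _ , _ , _ , r | _ , _ ∷ pr
      rewrite rebuildˢ-> {x} {e} {t} {walkedˢ o x s} e<x =
      (ℕ.m≤n⇒m≤n+o _ a , b) ◁ e ▷ perform-balancedˢ s r pr bs

  performAll-balanced : ∀ {n} (os : Vec Op n) xs t →
                        Sorted (entries t) → Positive (entries t) → Balanced t →
                        Balanced (performAll (build builder) os xs t)
  performAll-balanced []       []       t sorted pos b = b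
  performAll-balanced (o ∷ os) (x ∷ xs) t sorted pos b =
    performAll-balanced os xs _ (perform-sorted o x t sorted pos)
      (perform-positive o x t sorted pos) (proj₁ (perform-balanced o x t sorted pos b))

  sabt-balanced : ∀ {n} (os : Vec Op n) xs ks →
                  Balanced (performAll (build builder) os xs (build builder (tally ks)))
  sabt-balanced os xs ks =
    performAll-balanced os xs _ (subst Sorted (sym es≡) (tally-sorted ks))
      (subst Positive (sym es≡) (All.map proj₁ (tally-clean ks)))
      (proj₁ (build-balanced (tally-sorted ks) (tally-clean ks)))
    where es≡ = proj₁ (built builder _ (tally-sorted ks) (tally-clean ks))

-- Search time

module _ where

  open ℕ.≤-Reasoning
  open +-*-Solver

  -- The hypothesis on `p` and `q` says that q/p is at most 1/√2, stated with squares to stay within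
  -- the natural numbers. Squaring the bound on `a` and cancelling `p * p` gives the claim.
  scaled-squares : ∀ p q .{{_ : NonZero (p * p)}} → 2 * (q * q) ≤ p * p →
                   ∀ {a m} → p * a ≤ q * m → 2 * (a * a) ≤ m * m
  scaled-squares p q 2q²≤p² {a} {m} pa≤qm = ℕ.*-cancelˡ-≤ (p * p) (begin
    p * p * (2 * (a * a))
      ≡⟨ solve 2 (λ p a → p :* p :* (con 2 :* (a :* a)) := con 2 :* ((p :* a) :* (p :* a))) refl p a ⟩
    2 * ((p * a) * (p * a))  ≤⟨ ℕ.*-monoʳ-≤ 2 (ℕ.*-mono-≤ pa≤qm pa≤qm) ⟩
    2 * ((q * m) * (q * m))
      ≡⟨ solve 2 (λ q m → con 2 :* ((q :* m) :* (q :* m)) := con 2 :* (q :* q) :* (m :* m)) refl q m ⟩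
    2 * (q * q) * (m * m)    ≤⟨ ℕ.*-monoˡ-≤ (m * m) 2q²≤p² ⟩
    p * p * (m * m)          ∎)

  -- The factor 7/12 = 1/3 + 1/4 between a node and its child is less than 1/√2.
  child-halves-square : ∀ {B} → 2 ≤ B → ∀ {m im C} → im ≤ m → 4 * C ≤ im →
                        ∀ a → a * (B + 1) ≤ im + C * (B + 1) → 2 * (a * a) ≤ m * m
  child-halves-square {B} 2≤B {m} {im} {C} im≤m 4C≤im a a≤ =
    -- Here 98 is 2 · 7² and 98 + 46 is 12².
    scaled-squares 12 7 (ℕ.m≤m+n 98 46) {a} {m} 12a≤7m
    where
    -- Discounting the at most `C` accesses gained since the build leaves `r`, which is at most a
    -- third of `im` because `B + 1` is at least 3. Truncation does no harm: `a ≤ C + r` holds in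
    -- any case.
    r = a ∸ C
    3r≤im : 3 * r ≤ im
    3r≤im = begin
      3 * r                      ≡⟨ ℕ.*-comm 3 r ⟩
      r * 3                      ≤⟨ ℕ.*-monoʳ-≤ r (ℕ.+-monoˡ-≤ 1 2≤B) ⟩
      r * (B + 1)                ≡⟨ ℕ.*-distribʳ-∸ (B + 1) a C ⟩
      a * (B + 1) ∸ C * (B + 1)
        ≤⟨ ℕ.m≤n+o⇒m∸n≤o _ (C * (B + 1)) (ℕ.≤-trans a≤ (ℕ.≤-reflexive (ℕ.+-comm im _))) ⟩
      im                         ∎
    12a≤7m : 12 * a ≤ 7 * m
    12a≤7m = begin
      12 * a                     ≤⟨ ℕ.*-monoʳ-≤ 12 (ℕ.m≤n+m∸n a C) ⟩
      12 * (C + r)               ≡⟨ ℕ.*-distribˡ-+ 12 C r ⟩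
      12 * C + 12 * r            ≡⟨ cong₂ _+_ (ℕ.*-assoc 3 4 C) (ℕ.*-assoc 4 3 r) ⟩
      3 * (4 * C) + 4 * (3 * r)  ≤⟨ ℕ.+-mono-≤ (ℕ.*-monoʳ-≤ 3 4C≤im) (ℕ.*-monoʳ-≤ 4 3r≤im) ⟩
      3 * im + 4 * im            ≡⟨ sym (ℕ.*-distribʳ-+ im 3 4) ⟩
      7 * im                     ≤⟨ ℕ.*-monoʳ-≤ 7 im≤m ⟩
      7 * m                      ∎

  ^-cancelʳ-≤ : ∀ {m n} b → 1 ℕ.< b → b ^ m ≤ b ^ n → m ≤ n
  ^-cancelʳ-≤ b 1<b le = ℕ.≮⇒≥ (λ n<m → ℕ.<⇒≱ (ℕ.^-monoʳ-< b 1<b n<m) le)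

  ^-distribʳ-* : ∀ m n v → (m * n) ^ v ≡ m ^ v * n ^ v
  ^-distribʳ-* m n zero    = refl
  ^-distribʳ-* m n (suc v) rewrite ^-distribʳ-* m n v =
    solve 4 (λ m n a b → (m :* n) :* (a :* b) := (m :* a) :* (n :* b)) refl m n (m ^ v) (n ^ v)

  -- Logarithms are compared through integer powers: the `v`-th power of the bound on `2 ^ d` meets
  -- the square of the bound on `m ^ v`, and the positive factor `n ^ v * n ^ v` cancels. Working
  -- with squares is what doubles `u`.
  depth-bound : ∀ {d m n} → 1 ≤ n → 2 ^ d * (n * n) ≤ m * m →
                ∀ u v → m ^ v ≤ 2 ^ u * n ^ v → d * v ≤ u + u
  depth-bound {d} {m} {n} 1≤n n≤m u v m≤ =
    ^-cancelʳ-≤ 2 ℕ.≤-refl (ℕ.*-cancelʳ-≤ _ _ (n ^ v * n ^ v) {{nz}} (begin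
      2 ^ (d * v) * (n ^ v * n ^ v)
        ≡⟨ cong₂ _*_ (sym (ℕ.^-*-assoc 2 d v)) (sym (^-distribʳ-* n n v)) ⟩
      (2 ^ d) ^ v * (n * n) ^ v            ≡⟨ sym (^-distribʳ-* (2 ^ d) (n * n) v) ⟩
      (2 ^ d * (n * n)) ^ v                ≤⟨ ℕ.^-monoˡ-≤ v n≤m ⟩
      (m * m) ^ v                          ≡⟨ ^-distribʳ-* m m v ⟩
      m ^ v * m ^ v                        ≤⟨ ℕ.*-mono-≤ m≤ m≤ ⟩
      (2 ^ u * n ^ v) * (2 ^ u * n ^ v)
        ≡⟨ solve 2 (λ p q → (p :* q) :* (p :* q) := (p :* p) :* (q :* q)) refl (2 ^ u) (n ^ v) ⟩
      2 ^ u * 2 ^ u * (n ^ v * n ^ v)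
        ≡⟨ cong (_* (n ^ v * n ^ v)) (sym (ℕ.^-distribˡ-+-* 2 u u)) ⟩
      2 ^ (u + u) * (n ^ v * n ^ v)        ∎))
    where
    instance n≢0 : NonZero n
             n≢0 = >-nonZero 1≤n
    nz : NonZero (n ^ v * n ^ v)
    nz = ℕ.m*n≢0 (n ^ v) (n ^ v) {{ℕ.m^n≢0 n v}} {{ℕ.m^n≢0 n v}}

-- Each comparison uses up one unit of fuel. Inside a node this yields at most `B` comparisons,
-- which is enough because the final constant may depend on `B`.
binarySearch≤fuel : ∀ n x ks → binarySearch n x ks ≤ n
binarySearch≤fuel zero    x ks = z≤n
binarySearch≤fuel (suc n) x ks with splitAt ⌊ length ks /2⌋ ks
... | _ , []     = z≤n
... | l , y ∷ r with ℤ.<-cmp x y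
...   | tri< _ _ _ = s≤s (binarySearch≤fuel n x l)
...   | tri≈ _ _ _ = s≤s z≤n
...   | tri> _ _ _ = s≤s (binarySearch≤fuel n x r)

hasKeyWith⇒found : ∀ x m n t → hasKeyWith x m n t ≡ true →
                   accesses t ≡ m × ∃[ e ] (find x t ≡ just e × ac e ≡ n)
hasKeyWith⇒found x m n t has with accesses t ℕ.≡ᵇ m in a≡ | find x t in found
-- In every other case the test computes to `false`, contradicting `has`.
... | true | just (entry k n′ false) =
  ℕ.≡ᵇ⇒≡ (accesses t) m (Equivalence.from T-≡ a≡) , _ , refl , ℕ.≡ᵇ⇒≡ n′ n (Equivalence.from T-≡ has)

module Searching {B : ℕ} (2≤B : 2 ≤ B) where

  open Balance B
  open ℕ.≤-Reasoning
  open +-*-Solver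

  -- The witness `d` is the number of levels from the current node down to the one holding the key.
  -- Each level doubles the factor in front of the squared count, starting from `ac e ≤ m` at the
  -- holding node. The current node's own search accounts for `suc d` here and for plain `d` in
  -- `searchTimeˢ`.
  searchTime-depth  : ∀ x {e} t → Balanced t → find x t ≡ just e →
    ∃[ d ] (searchTime x t ≤ B * suc d × 2 ^ d * (ac e * ac e) ≤ accesses t * accesses t)
  searchTime-depthˢ : ∀ x {e k m} s → total (entriesˢ s) ≤ m →
    (∀ a → a * (B + 1) ≤ k → 2 * (a * a) ≤ m * m) →
    Balancedˢ k s → findˢ x s ≡ just e →
    ∃[ d ] (searchTimeˢ x s ≤ B * d × 2 ^ d * (ac e * ac e) ≤ m * m)
  searchTime-child  : ∀ x {e k} m t →
    (∀ a → a * (B + 1) ≤ k → 2 * (a * a) ≤ m * m) →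
    accesses t * (B + 1) ≤ k → Balanced t → find x t ≡ just e →
    ∃[ d ] (searchTime x t ≤ B * d × 2 ^ d * (ac e * ac e) ≤ m * m)

  searchTime-depth x (node m im C s) (node reps≤B im≤m 4C≤im total≤m bs) found =
    let d , time≤ , ac≤ = searchTime-depthˢ x {m = m} s total≤m
          (child-halves-square 2≤B {m} {im} {C} im≤m 4C≤im) bs found
    in d , (begin
      nodeSearchTime x s + searchTimeˢ x s
        ≤⟨ ℕ.+-mono-≤ (ℕ.≤-trans (binarySearch≤fuel (length (reps s)) x _) reps≤B) time≤ ⟩
      B + B * d  ≡⟨ sym (ℕ.*-suc B d) ⟩
      B * suc d  ∎) , ac≤

  searchTime-child x {e} {k} m t halve a≤k b found with searchTime-depth x t b found
  ... | d , time≤ , ac≤ = suc d , time≤ , (begin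
      2 * 2 ^ d * (ac e * ac e)      ≡⟨ ℕ.*-assoc 2 (2 ^ d) _ ⟩
      2 * (2 ^ d * (ac e * ac e))    ≤⟨ ℕ.*-monoʳ-≤ 2 ac≤ ⟩
      2 * (accesses t * accesses t)  ≤⟨ halve (accesses t) a≤k ⟩
      m * m                          ∎)

  searchTime-depthˢ x {m = m} (last t) total≤m halve (last a≤k b) found =
    searchTime-child x m t halve a≤k b found
  searchTime-depthˢ x {m = m} (t ◁ e ▷ s) total≤m halve ((a≤k , b) ◁ .e ▷ bs) found
    rewrite total-++-∷ (entries t) e (entriesˢ s) with ℤ.<-cmp x (key e) | found
  ... | tri< _ _ _ | found′ = searchTime-child x m t halve a≤k b found′
  ... | tri≈ _ _ _ | refl   = 0 , z≤n , (begin
      1 * (ac e * ac e)  ≡⟨ ℕ.*-identityˡ _ ⟩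
      ac e * ac e        ≤⟨ ℕ.*-mono-≤ ac≤m ac≤m ⟩
      m * m              ∎)
    where
    ac≤m : ac e ≤ m
    ac≤m = ℕ.m+n≤o⇒m≤o (ac e) (ℕ.m+n≤o⇒n≤o (total (entries t)) total≤m)
  ... | tri> _ _ _ | found′ = searchTime-depthˢ x s
      (ℕ.m+n≤o⇒n≤o (ac e) (ℕ.m+n≤o⇒n≤o (total (entries t)) total≤m)) halve bs found′

  -- Of the factor 3, one unit pays for the root through `v ≤ u`, and two pay for the `d` levels
  -- below it through `depth-bound`.
  searchTime-log : ∀ x {e} t → Balanced t → find x t ≡ just e → 1 ≤ ac e →
                   ∀ u v → v ≤ u → accesses t ^ v ≤ 2 ^ u * ac e ^ v →
                   v * searchTime x t ≤ B * 3 * u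
  searchTime-log x t b found 1≤ac u v v≤u m≤ with searchTime-depth x t b found
  ... | d , time≤ , ac≤ = begin
      v * searchTime x t  ≤⟨ ℕ.*-monoʳ-≤ v time≤ ⟩
      v * (B * suc d)
        ≡⟨ solve 3 (λ v b d → v :* (b :* (con 1 :+ d)) := b :* (v :+ d :* v)) refl v B d ⟩
      B * (v + d * v)     ≤⟨ ℕ.*-monoʳ-≤ B (ℕ.+-mono-≤ v≤u (depth-bound {d} 1≤ac ac≤ u v m≤)) ⟩
      B * (u + (u + u))
        ≡⟨ solve 2 (λ b u → b :* (u :+ (u :+ u)) := b :* con 3 :* u) refl B u ⟩
      B * 3 * u           ∎

  searchTime-hasKeyWith : ∀ x m n t → Balanced t → 1 ≤ n → hasKeyWith x m n t ≡ true →
                          ∀ u v → v ≤ u → m ^ v ≤ 2 ^ u * n ^ v →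
                          v * searchTime x t ≤ B * 3 * u
  searchTime-hasKeyWith x m n t b 1≤n has with hasKeyWith⇒found x m n t has
  ... | refl , e , found , refl = searchTime-log x t b found 1≤n

-- Expectations in an ordered field

-- A probability mass function promises nonnegative masses only inside the interval, so the
-- summation points have to be located there.
range-bounds : ∀ a b → All (λ x → a ℤ.≤ x × x ℤ.< b) (range a b)
range-bounds a b = All.map⁺ (All.applyUpTo⁺₁ (λ i → i) _ bounds)
  where
  z = (b ℤ.- a) ℤ.⊔ 0ℤ
  bounds : ∀ {i} → i ℕ.< ℤ.∣ z ∣ → a ℤ.≤ a ℤ.+ ℤ.+ i × a ℤ.+ ℤ.+ i ℤ.< b
  bounds {i} i<z = ℤ.i≤i+j a (ℤ.+ i) , below
    where
    i<ᶻz : ℤ.+ i ℤ.< z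
    i<ᶻz = subst (ℤ.+ i ℤ.<_) (ℤ.0≤i⇒+∣i∣≡i (ℤ.i≤j⊔i (b ℤ.- a) 0ℤ)) (ℤ.+<+ i<z)
    a+[b-a]≡b : a ℤ.+ (b ℤ.- a) ≡ b
    a+[b-a]≡b = trans (ℤ.+-comm a _) (trans (ℤ.+-assoc b _ a)
      (trans (cong (λ c → b ℤ.+ c) (ℤ.+-inverseˡ a)) (ℤ.+-identityʳ b)))
    below : a ℤ.+ ℤ.+ i ℤ.< b
    below with ℤ.⊔-sel (b ℤ.- a) 0ℤ
    ... | inj₁ z≡b-a = subst (a ℤ.+ ℤ.+ i ℤ.<_) a+[b-a]≡b
                         (ℤ.+-monoʳ-< a (subst (ℤ.+ i ℤ.<_) z≡b-a i<ᶻz))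
    ... | inj₂ z≡0 with subst (ℤ.+ i ℤ.<_) z≡0 i<ᶻz
    ...   | ℤ.+<+ ()

-- Order and arithmetic of the field.

module OrderedFieldProperties {c ℓ₁ ℓ₂} (F : OrderedField c ℓ₁ ℓ₂) where

  open OrderedField F
    renaming ( _+_ to _⊕_; _*_ to _⊛_; _≤_ to _≤ᶠ_; _<_ to _<ᶠ_; _-_ to _⊝_
             ; refl to ≈-refl; sym to ≈-sym; trans to ≈-trans; zero to *-zero )
  open IsStrictPartialOrder isStrictPartialOrder
    using (irrefl; asym; <-respˡ-≈; <-respʳ-≈) renaming (trans to <-trans)

  open CommutativeRing (HeytingCommutativeRing.commutativeRing heytingCommutativeRing)
    using (ring; semiring; commutativeSemiring)
  open import Algebra.Properties.Semiring.Mult semiring using (×1-homo-*)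
  open import Algebra.Properties.Ring ring using (-‿distribˡ-*; -‿distribʳ-*; -‿involutive; x[y-z]≈xy-xz; -0#≈0#)
  open import Algebra.Solver.Ring.NaturalCoefficients.Default commutativeSemiring
    using (solve; _:+_; _:*_; _:=_)
  open import Relation.Binary.Reasoning.Setoid setoid

  -- This takes the place of trichotomy: cotransitivity of apartness separates `z` from `x` or from
  -- `y`, and if the resulting inequality points the wrong way, transitivity with `x < y` gives the
  -- other alternative.
  <-cotrans : ∀ {x y} → x <ᶠ y → ∀ z → x <ᶠ z ⊎ z <ᶠ y
  <-cotrans x<y z with #-cotrans (<⇒# x<y) z
  ... | inj₁ x#z with #⇒<⊎> x#z
  ...   | inj₁ x<z = inj₁ x<z
  ...   | inj₂ z<x = inj₂ (<-trans z<x x<y)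
  <-cotrans x<y z | inj₂ z#y with #⇒<⊎> z#y
  ...   | inj₁ z<y = inj₂ z<y
  ...   | inj₂ y<z = inj₁ (<-trans x<y y<z)

  ≤-reflexive : ∀ {x y} → x ≈ y → x ≤ᶠ y
  ≤-reflexive x≈y = irrefl (≈-sym x≈y)

  ≤-resp₂-≈ : ∀ {x x′ y y′} → x ≈ x′ → y ≈ y′ → x ≤ᶠ y → x′ ≤ᶠ y′
  ≤-resp₂-≈ x≈ y≈ x≤y y′<x′ = x≤y (<-respʳ-≈ (≈-sym x≈) (<-respˡ-≈ (≈-sym y≈) y′<x′))

  +-cancelʳ : ∀ x z → (x ⊕ z) ⊕ - z ≈ x
  +-cancelʳ x z = begin
    (x ⊕ z) ⊕ - z  ≈⟨ +-assoc x z (- z) ⟩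
    x ⊕ (z ⊕ - z)  ≈⟨ +-congˡ (-‿inverseʳ z) ⟩
    x ⊕ 0#         ≈⟨ +-identityʳ x ⟩
    x              ∎

  +-cancelʳ-< : ∀ {x y} z → x ⊕ z <ᶠ y ⊕ z → x <ᶠ y
  +-cancelʳ-< z lt = <-respˡ-≈ (+-cancelʳ _ z) (<-respʳ-≈ (+-cancelʳ _ z) (+-monoˡ-< (- z) lt))

  +-cancelˡ-< : ∀ {x y} z → z ⊕ x <ᶠ z ⊕ y → x <ᶠ y
  +-cancelˡ-< z lt = +-cancelʳ-< z (<-respˡ-≈ (+-comm z _) (<-respʳ-≈ (+-comm z _) lt))

  -- As `≤` is a negation, a violation is assumed and compared with `y ⊕ z`; either outcome refutes
  -- one of the hypotheses after cancellation.
  +-mono-≤ : ∀ {x y z w} → x ≤ᶠ y → z ≤ᶠ w → x ⊕ z ≤ᶠ y ⊕ w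
  +-mono-≤ {x} {y} {z} {w} x≤y z≤w lt with <-cotrans lt (y ⊕ z)
  ... | inj₁ yw<yz = z≤w (+-cancelˡ-< y yw<yz)
  ... | inj₂ yz<xz = x≤y (+-cancelʳ-< z yz<xz)

  x<0⇒0<-x : ∀ {x} → x <ᶠ 0# → 0# <ᶠ - x
  x<0⇒0<-x {x} x<0 =
    <-respˡ-≈ (-‿inverseʳ x) (<-respʳ-≈ (+-identityˡ (- x)) (+-monoˡ-< (- x) x<0))

  -- If `1#` were negative, then `- 1#` would be positive, and so would its square `1#`.
  0≤1 : 0# ≤ᶠ 1#
  0≤1 1<0 = asym 1<0 (<-respʳ-≈ 1≈ (*-positive 0<-1 0<-1))
    where
    0<-1 = x<0⇒0<-x 1<0
    1≈ : - 1# ⊛ - 1# ≈ 1#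
    1≈ = begin
      - 1# ⊛ - 1#    ≈⟨ ≈-sym (-‿distribˡ-* 1# (- 1#)) ⟩
      - (1# ⊛ - 1#)  ≈⟨ -‿cong (*-identityˡ (- 1#)) ⟩
      - - 1#         ≈⟨ -‿involutive 1# ⟩
      1#             ∎

  x-0≈x : ∀ x → x ⊝ 0# ≈ x
  x-0≈x x = ≈-trans (+-congˡ -0#≈0#) (+-identityʳ x)

  -- Apartness from `0#` amounts to invertibility, and `y` times an inverse of the product inverts
  -- `x`.
  xy#0⇒x#0 : ∀ {x y} → x ⊛ y # 0# → x # 0#
  xy#0⇒x#0 {x} {y} xy#0 with #⇒invertible xy#0
  ... | i , _ , xyi≈1 = invertible⇒# (y ⊛ i , ≈-trans (*-comm _ _) yi-inverse , yi-inverse)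
    where
    yi-inverse : (x ⊝ 0#) ⊛ (y ⊛ i) ≈ 1#
    yi-inverse = begin
      (x ⊝ 0#) ⊛ (y ⊛ i)  ≈⟨ *-congʳ (x-0≈x x) ⟩
      x ⊛ (y ⊛ i)         ≈⟨ ≈-sym (*-assoc x y i) ⟩
      x ⊛ y ⊛ i           ≈⟨ *-congʳ (≈-sym (x-0≈x (x ⊛ y))) ⟩
      (x ⊛ y ⊝ 0#) ⊛ i    ≈⟨ xyi≈1 ⟩
      1#                  ∎

  -- An order-theoretic case split on the factors is not available, but a
  -- negative product is invertible, which makes both factors invertible.
  *-nonnegative : ∀ {x y} → 0# ≤ᶠ x → 0# ≤ᶠ y → 0# ≤ᶠ x ⊛ y
  *-nonnegative {x} {y} 0≤x 0≤y xy<0 with #⇒<⊎> (xy#0⇒x#0 (<⇒# xy<0))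
                                        | #⇒<⊎> (xy#0⇒x#0 (<⇒# (<-respˡ-≈ (*-comm x y) xy<0)))
  ... | inj₁ x<0 | _        = 0≤x x<0
  ... | inj₂ _   | inj₁ y<0 = 0≤y y<0
  ... | inj₂ 0<x | inj₂ 0<y = asym xy<0 (*-positive 0<x 0<y)

  *-monoˡ-≤ : ∀ {w x y} → 0# ≤ᶠ w → x ≤ᶠ y → w ⊛ x ≤ᶠ w ⊛ y
  *-monoˡ-≤ {w} {x} {y} 0≤w x≤y wy<wx = *-nonnegative 0≤w 0≤y-x w[y-x]<0
    where
    0≤y-x : 0# ≤ᶠ y ⊝ x
    0≤y-x lt = x≤y (+-cancelʳ-< (- x) (<-respʳ-≈ (≈-sym (-‿inverseʳ x)) lt))
    w[y-x]<0 : w ⊛ (y ⊝ x) <ᶠ 0#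
    w[y-x]<0 = <-respˡ-≈ (≈-sym (x[y-z]≈xy-xz w y x))
                 (<-respʳ-≈ (-‿inverseʳ (w ⊛ x)) (+-monoˡ-< (- (w ⊛ x)) wy<wx))

  fromℕ-mono-≤ : ∀ {m n} → m ≤ n → fromℕ m ≤ᶠ fromℕ n
  fromℕ-mono-≤ {n = zero}  z≤n       = ≤-reflexive ≈-refl
  fromℕ-mono-≤ {n = suc n} z≤n       =
    ≤-resp₂-≈ (+-identityˡ 0#) ≈-refl (+-mono-≤ 0≤1 (fromℕ-mono-≤ {n = n} z≤n))
  fromℕ-mono-≤ (s≤s m≤n) = +-mono-≤ (≤-reflexive ≈-refl) (fromℕ-mono-≤ m≤n)

  fromℕ-* : ∀ m n → fromℕ (m * n) ≈ fromℕ m ⊛ fromℕ n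
  fromℕ-* = ×1-homo-*

  module _ {x} (0<x : 0# <ᶠ x) where

    *-inverseʳ : x ⊛ inverse x 0<x ≈ 1#
    *-inverseʳ with #⇒invertible (#-sym (<⇒# 0<x))
    ... | i , _ , xi≈1 = ≈-trans (*-congʳ (≈-sym (x-0≈x x))) xi≈1

    -- A negative inverse would make `- 1#` a product of two positive elements.
    inverse-nonnegative : 0# ≤ᶠ inverse x 0<x
    inverse-nonnegative i<0 =
      0≤1 (<-respˡ-≈ (+-identityˡ 1#) (<-respʳ-≈ (-‿inverseˡ 1#) (+-monoˡ-< 1# 0<-1)))
      where
      0<-1 : 0# <ᶠ - 1#
      0<-1 = <-respʳ-≈ (≈-trans (≈-sym (-‿distribʳ-* x _)) (-‿cong *-inverseʳ))
               (*-positive 0<x (x<0⇒0<-x i<0))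

  -- Carrying `α` and `β` along proves linearity and monotonicity in one induction. Premise and
  -- conclusion have the same shape, so the result iterates over successive draws.
  sumOver-scaled-mono : ∀ {w f g : ℤ → Carrier} α β {xs} → All (λ x → 0# ≤ᶠ w x) xs →
                        (∀ x → α ⊛ f x ≤ᶠ β ⊛ g x) →
                        α ⊛ sumOver xs (λ x → w x ⊛ f x) ≤ᶠ β ⊛ sumOver xs (λ x → w x ⊛ g x)
  sumOver-scaled-mono α β [] f≤g = ≤-reflexive (≈-trans (zeroʳ α) (≈-sym (zeroʳ β)))
  sumOver-scaled-mono α β (0≤w ∷ 0≤ws) f≤g =
    ≤-resp₂-≈ (regroup _ _ _ _) (regroup _ _ _ _)
      (+-mono-≤ (*-monoˡ-≤ 0≤w (f≤g _)) (sumOver-scaled-mono α β 0≤ws f≤g))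
    where
    regroup : ∀ α w f s → w ⊛ (α ⊛ f) ⊕ α ⊛ s ≈ α ⊛ (w ⊛ f ⊕ s)
    regroup = solve 4 (λ α w f s → w :* (α :* f) :+ α :* s := α :* (w :* f :+ s)) ≈-refl

  -- Comparison of expectations.

  open Probability F

  expectIID-scaled-mono : ∀ {a b} (p : PMF a b) n {f g : Vec ℤ n → Carrier} α β →
                          (∀ xs → α ⊛ f xs ≤ᶠ β ⊛ g xs) →
                          α ⊛ expectIID p n f ≤ᶠ β ⊛ expectIID p n g
  expectIID-scaled-mono         p zero    α β f≤g = f≤g []
  expectIID-scaled-mono {a} {b} p (suc n) α β f≤g =
    sumOver-scaled-mono α β
      (All.map (λ {x} (a≤x , x<b) → nonnegative p x a≤x x<b) (range-bounds a b))
      (λ x → expectIID-scaled-mono p n α β (λ xs → f≤g (x ∷ xs)))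

  module _ {B : ℕ} (builder : SABTBuilder B) {a b : ℤ} (p : PMF a b)
           (n′ : ℕ) {n : ℕ} (ops : Vec Op n) where

    open RandomSABT builder p n′ ops

    -- The integrand scaled by `α` is at most `β` times the indicator of `A`: on the event by
    -- hypothesis, off it because both sides vanish. Taking expectations and multiplying by the
    -- nonnegative inverse of the probability gives the bound.
    conditionalExpectation-scaled-≤ :
      ∀ (f : Tree → Carrier) A (0<P : 0# <ᶠ probability A) α β →
      (∀ ks xs → A (sabt ks xs) ≡ true → α ⊛ f (sabt ks xs) ≤ᶠ β) →
      α ⊛ conditionalExpectation f A 0<P ≤ᶠ β
    conditionalExpectation-scaled-≤ f A 0<P α β f≤β =
      ≤-resp₂-≈ lhs rhs (*-monoˡ-≤ (inverse-nonnegative 0<P)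
        (expectIID-scaled-mono p n′ α β λ ks →
         expectIID-scaled-mono p n α β λ xs → pointwise ks xs))
      where
      P⁻¹ = inverse (probability A) 0<P
      E   = expectation (λ t → if A t then f t else 0#)
      lhs : P⁻¹ ⊛ (α ⊛ E) ≈ α ⊛ (E ⊛ P⁻¹)
      lhs = solve 3 (λ i α e → i :* (α :* e) := α :* (e :* i)) ≈-refl P⁻¹ α E
      rhs : P⁻¹ ⊛ (β ⊛ probability A) ≈ β
      rhs = begin
        P⁻¹ ⊛ (β ⊛ probability A)
          ≈⟨ solve 3 (λ i β q → i :* (β :* q) := β :* (q :* i)) ≈-refl P⁻¹ β (probability A) ⟩
        β ⊛ (probability A ⊛ P⁻¹)  ≈⟨ *-congˡ (*-inverseʳ 0<P) ⟩
        β ⊛ 1#                     ≈⟨ *-identityʳ β ⟩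
        β                          ∎
      pointwise : ∀ ks xs → α ⊛ (if A (sabt ks xs) then f (sabt ks xs) else 0#) ≤ᶠ
                            β ⊛ (if A (sabt ks xs) then 1# else 0#)
      pointwise ks xs with A (sabt ks xs) | f≤β ks xs
      ... | true  | bound = ≤-resp₂-≈ ≈-refl (≈-sym (*-identityʳ β)) (bound refl)
      ... | false | _     = ≤-reflexive (≈-trans (zeroʳ α) (≈-sym (zeroʳ β)))

theorem9 : ∀ {c ℓ₁ ℓ₂} (F : OrderedField c ℓ₁ ℓ₂) →
    let module F = OrderedField F
        open Probability F
    in
    (B : ℕ) → 2 ≤ B →
    ∃[ C ] ((builder : SABTBuilder B) (a b : ℤ) (p : PMF a b) (n′ n : ℕ) (ops : Vec Op n) →
      let open RandomSABT builder p n′ ops in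
      (x : ℤ) (m ac : ℕ) → 1 ≤ ac →
      (0<P : F.0# F.< probability (hasKeyWith x m ac)) →
      conditionalExpectation (λ T → F.fromℕ (searchTime x T)) (hasKeyWith x m ac) 0<P ≤ C ·log₂[ m / ac ])
-- The constant is that of `searchTime-log`. The bound holds for every outcome in the event and is
-- averaged only afterwards.
theorem9 F B 2≤B = B * 3 , λ builder a b p n′ n ops x m ac 1≤ac 0<P u v _ v≤u m≤ →
  conditionalExpectation-scaled-≤ builder p n′ ops (λ t → F.fromℕ (searchTime x t)) (hasKeyWith x m ac) 0<P
    (F.fromℕ v) (F.fromℕ (B * 3 * u)) λ ks xs has →
      let t = RandomSABT.sabt builder p n′ ops ks xs in
      ≤-resp₂-≈ (fromℕ-* v (searchTime x t)) F.refl (fromℕ-mono-≤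
        (searchTime-hasKeyWith x m ac t (sabt-balanced builder ops xs (Vec.toList ks))
          1≤ac has u v v≤u m≤))
  where
  module F = OrderedField F
  open OrderedFieldProperties F
  open Probability F
  open Performing 2≤B
  open Searching 2≤B
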